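{- Let $\gamma \geq 0$ be an integer. As a set-operad, the underlying set of $\mathsf{Dias}_\gamma$ is the set of all words on the alphabet $\{0\} \cup [\gamma]$ containing exactly one occurrence of $0$.
   Context: $[\gamma] = \{1, \dots, \gamma\}$. Operad means nonsymmetric operad (partial compositions $\circ_i$, unit in arity $1$). Let $\mathcal{M}_\gamma$ be the monoid $\{0\} \cup [\gamma]$ with product $\max$. The operad $\mathsf{T}\mathcal{M}_\gamma$ has as component of arity $n \geq 1$ the linear span of the words $u_1 \dots u_n$ of length $n$ on $\mathcal{M}_\gamma$, with partial compositions, for words $u$ of length $n$ and $v$ of length $m$ and $i \in [n]$, $u \circ_i v := u_1 \dots u_{i-1}\, \max(u_i, v_1) \dots \max(u_i, v_m)\, u_{i+1} \dots u_n$, and with unit the one-letter word $0$. $\mathsf{Dias}_\gamma$ is the suboperad of $\mathsf{T}\mathcal{M}_\gamma$ generated by the words $0a$ and $a0$, $a \in [\gamma]$. Since a partial composition of two words is a single word, $\mathsf{Dias}_\gamma$ is regarded as a set-operad: its underlying set is the set of words obtained from the unit $0$ and the generating words by partial compositions. -}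

module Defs where

open import Level using (0ℓ)
open import Data.Nat.Base using (ℕ; suc)
open import Data.Fin.Base using (Fin; zero; suc)
open import Data.Fin.Properties using (_≟_; ≤-totalOrder)
open import Data.List.Base as List using ([]; _∷_; filter)
open import Data.List.NonEmpty.Base using (List⁺; _∷_; _∷⁺_; _⁺++_; [_]; length; map; toList)
open import Relation.Binary.PropositionalEquality.Core using (_≡_)
open import Relation.Unary using (Pred)

import Algebra.Construct.NaturalChoice.Max as Max

private
  variable
    γ : ℕ

-- {0} ∪ [γ], with 0 represented by zero and a ∈ [γ] by a successor.
Letter : ℕ → Set
Letter γ = Fin (suc γ)

max : Letter γ → Letter γ → Letter γ
max {γ} = Max._⊔_ (≤-totalOrder (suc γ))

-- The words of all arities n ≥ 1 together; the arity of a word is its length.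
Word : ℕ → Set
Word γ = List⁺ (Letter γ)

infixl 7 _∘[_]_

_∘[_]_ : (u : Word γ) → Fin (length u) → Word γ → Word γ
(x ∷ xs)     ∘[ zero  ] v = map (max x) v ⁺++ xs
(x ∷ y ∷ ys) ∘[ suc i ] v = x ∷⁺ ((y ∷ ys) ∘[ i ] v)

unit : Word γ
unit = [ zero ]

-- Underlying set of the set-suboperad generated by G: the smallest set of
-- words that contains the unit and G and is closed under partial composition.
data Generated (G : Pred (Word γ) 0ℓ) : Pred (Word γ) 0ℓ where
  unit∈ : Generated G unit
  gen∈  : ∀ {w} → G w → Generated G w
  ∘∈    : ∀ {u v} → Generated G u → (i : Fin (length u)) → Generated G v →
          Generated G (u ∘[ i ] v)

data Generator (γ : ℕ) : Pred (Word γ) 0ℓ where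
  0a : (a : Fin γ) → Generator γ (zero ∷ suc a ∷ [])
  a0 : (a : Fin γ) → Generator γ (suc a ∷ zero ∷ [])

Dias : (γ : ℕ) → Pred (Word γ) 0ℓ
Dias γ = Generated (Generator γ)

zeroCount : Word γ → ℕ
zeroCount w = List.length (filter (_≟ zero) (toList w))

ExactlyOneZero : (γ : ℕ) → Pred (Word γ) 0ℓ
ExactlyOneZero γ w = zeroCount w ≡ 1

{-# OPTIONS --safe #-}

-- Substituting into a nonzero letter creates no 0, and substituting v into a 0
-- replaces that 0 by the 0s of v; so composing with a word having a single 0
-- preserves the number of 0s.  Conversely, a word whose only 0 is at position
-- k + 1 is grown from its suffix 0 a₁ … aₘ by prepending the first k letters
-- through a0 ∘₂ w = aw, and 0 a₁ … aₘ comes from 0x ∘₁ 0a = 0ax.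
module Submission where

open import Defs
open import Data.Nat.Base using (ℕ; suc; _+_; z≤n)
open import Data.Nat.Properties using (suc-injective)
open import Data.Fin.Base using (Fin; zero; suc; _≤_)
open import Data.Fin.Properties using (_≟_; ≤-totalOrder)
open import Data.List.Base as List using (List; []; _∷_; _++_; filter)
open import Data.List.NonEmpty.Base using (_∷_; _∷⁺_; length; map; toList)
open import Data.List.Properties
  using (filter-++; filter-none; length-++; map-id; map-cong; ++-identityʳ)
open import Data.List.Relation.Unary.All using (universal)
open import Data.List.Relation.Unary.All.Properties using (map⁺)
open import Data.Product.Base using (_,_)
open import Relation.Binary.PropositionalEquality
open import Relation.Nullary.Negation.Core using (¬_)
open import Relation.Unary using (_≐_)

import Algebra.Construct.NaturalChoice.Max as Max

private
  variable
    γ : ℕ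

count₀ : List (Letter γ) → ℕ
count₀ xs = List.length (filter (_≟ zero) xs)

count₀-++ : (xs ys : List (Letter γ)) → count₀ (xs ++ ys) ≡ count₀ xs + count₀ ys
count₀-++ xs ys =
  trans (cong List.length (filter-++ (_≟ zero) xs ys)) (length-++ (filter (_≟ zero) xs))

max-identityˡ : (x : Letter γ) → max zero x ≡ x
max-identityˡ {γ} x = Max.x≤y⇒x⊔y≈y (≤-totalOrder (suc γ)) z≤n

max-suc≢0 : (a : Fin γ) (y : Letter γ) → max (suc a) y ≢ zero
max-suc≢0 {γ} a y eq = suc≰0 (subst (suc a ≤_) eq (Max.x≤x⊔y (≤-totalOrder (suc γ)) (suc a) y))
  where
  suc≰0 : ¬ suc a ≤ zero {γ}
  suc≰0 ()

map-max-0 : (xs : List (Letter γ)) → List.map (max zero) xs ≡ xs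
map-max-0 xs = trans (map-cong max-identityˡ xs) (map-id xs)

count₀-map-max-suc : (a : Fin γ) (xs : List (Letter γ)) → count₀ (List.map (max (suc a)) xs) ≡ 0
count₀-map-max-suc a xs =
  cong List.length (filter-none (_≟ zero) (map⁺ (universal (max-suc≢0 a) xs)))

-- The right-hand side is the contribution of `x` itself: `zero` is neutral for `max` and keeps the
-- single 0 of `v`, a nonzero letter keeps none. In the form `count₀ (x ∷ [])` it recombines with
-- the remaining letters through `count₀-++`.
zeroCount-map-max : (x : Letter γ) (v : Word γ) → zeroCount v ≡ 1 →
                    zeroCount (map (max x) v) ≡ count₀ (x ∷ [])
zeroCount-map-max zero    v v₀ = trans (cong count₀ (map-max-0 (toList v))) v₀
zeroCount-map-max (suc a) v v₀ = count₀-map-max-suc a (toList v)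

zeroCount-∘ : (u : Word γ) (i : Fin (length u)) (v : Word γ) → zeroCount v ≡ 1 →
              zeroCount (u ∘[ i ] v) ≡ zeroCount u
zeroCount-∘ (x ∷ xs) zero v v₀ = begin
  count₀ (toList (map (max x) v) ++ xs)        ≡⟨ count₀-++ (toList (map (max x) v)) xs ⟩
  zeroCount (map (max x) v) + count₀ xs        ≡⟨ cong (_+ count₀ xs) (zeroCount-map-max x v v₀) ⟩
  count₀ (x ∷ []) + count₀ xs                  ≡⟨ count₀-++ (x ∷ []) xs ⟨
  count₀ (x ∷ xs)                              ∎
  where open ≡-Reasoning
zeroCount-∘ (x ∷ y ∷ ys) (suc i) v v₀ = begin
  -- The filter is stuck on the unknown letter `x`, so the head is split off as a singleton around
  -- the induction hypothesis.
  count₀ (x ∷ toList w)            ≡⟨ count₀-++ (x ∷ []) (toList w) ⟩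
  count₀ (x ∷ []) + zeroCount w    ≡⟨ cong (count₀ (x ∷ []) +_) (zeroCount-∘ (y ∷ ys) i v v₀) ⟩
  count₀ (x ∷ []) + count₀ (y ∷ ys) ≡⟨ count₀-++ (x ∷ []) (y ∷ ys) ⟨
  count₀ (x ∷ y ∷ ys)              ∎
  where
  open ≡-Reasoning
  w = (y ∷ ys) ∘[ i ] v

Dias⇒oneZero : {w : Word γ} → Dias γ w → ExactlyOneZero γ w
Dias⇒oneZero unit∈              = refl
Dias⇒oneZero (gen∈ (0a a))      = refl
Dias⇒oneZero (gen∈ (a0 a))      = refl
Dias⇒oneZero (∘∈ {u} {v} p i q) = trans (zeroCount-∘ u i v (Dias⇒oneZero q)) (Dias⇒oneZero p)

Dias-∷⁺ : (a : Fin γ) {w : Word γ} → Dias γ w → Dias γ (suc a ∷⁺ w)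
Dias-∷⁺ {γ} a {x ∷ xs} p = subst (Dias γ) a0∘w≡aw (∘∈ (gen∈ (a0 a)) (suc zero) p)
  where
  a0∘w≡aw : (suc a ∷ zero ∷ []) ∘[ suc zero ] (x ∷ xs) ≡ suc a ∷ x ∷ xs
  -- Grafting at the last letter appends an empty remainder and applies `max zero` to each letter of
  -- the word; both act trivially.
  a0∘w≡aw = cong (suc a ∷_)
    (trans (++-identityʳ (List.map (max zero) (x ∷ xs))) (map-max-0 (x ∷ xs)))

Dias-insert : (a : Fin γ) {xs : List (Letter γ)} → Dias γ (zero ∷ xs) → Dias γ (zero ∷ suc a ∷ xs)
-- `max zero zero` and `max zero (suc a)` evaluate, so this composite is the required word by
-- computation.
Dias-insert a p = ∘∈ p zero (gen∈ (0a a))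

-- Each letter is inserted directly after the 0, so the word is built from its last letter
-- backwards. A `zero` in `xs` would make the count a successor.
leadingZero⇒Dias : (xs : List (Letter γ)) → count₀ xs ≡ 0 → Dias γ (zero ∷ xs)
leadingZero⇒Dias []           _   = unit∈
leadingZero⇒Dias (suc a ∷ xs) xs₀ = Dias-insert a (leadingZero⇒Dias xs xs₀)

oneZero⇒Dias : (x : Letter γ) (xs : List (Letter γ)) → ExactlyOneZero γ (x ∷ xs) → Dias γ (x ∷ xs)
oneZero⇒Dias zero    xs       w₀ = leadingZero⇒Dias xs (suc-injective w₀)
-- A nonzero head adds nothing to the count, so `w₀` also serves for the tail; the tail cannot be
-- empty, as the count would be 0.
oneZero⇒Dias (suc a) (y ∷ ys) w₀ = Dias-∷⁺ a (oneZero⇒Dias y ys w₀)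

proposition2p1p1 : (γ : ℕ) → Dias γ ≐ ExactlyOneZero γ
proposition2p1p1 γ = Dias⇒oneZero , λ { {x ∷ xs} → oneZero⇒Dias x xs }
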